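{- For every formula $\varphi$: $\emptyset\vdash_{\mathsf{iSLH}}\varphi$ if and only if the sequent $\Rightarrow\varphi$ (empty antecedent) is provable in $\mathsf{G4iSLt}$.
   Context: Formulas are built by the grammar $\varphi ::= p \mid \bot \mid \varphi\land\varphi \mid \varphi\lor\varphi \mid \varphi\to\varphi \mid \Box\varphi$, with $p$ ranging over a countably infinite set of propositional variables. For a multiset $\Gamma$, $\Box\Gamma=\{\Box\psi:\psi\in\Gamma\}$; a boxed formula is one of the form $\Box\psi$. The generalised Hilbert calculus $\mathsf{iSLH}$ derives expressions $\Gamma\vdash\varphi$ ($\Gamma$ a set of formulas) by the rules: (Ax) $\Gamma\vdash\varphi$ whenever $\varphi$ is an instance of an axiom; (El) $\Gamma\vdash\varphi$ whenever $\varphi\in\Gamma$; (Nec) from $\emptyset\vdash\varphi$ infer $\Gamma\vdash\Box\varphi$; (MP) from $\Gamma\vdash\varphi$ and $\Gamma\vdash\varphi\to\psi$ infer $\Gamma\vdash\psi$. The axioms are all instances of: $\varphi\to(\psi\to\varphi)$; $(\varphi\to(\psi\to\chi))\to((\varphi\to\psi)\to(\varphi\to\chi))$; $\varphi\to(\varphi\lor\psi)$; $\psi\to(\varphi\lor\psi)$; $(\varphi\to\chi)\to((\psi\to\chi)\to((\varphi\lor\psi)\to\chi))$; $(\varphi\land\psi)\to\varphi$; $(\varphi\land\psi)\to\psi$; $(\varphi\to\psi)\to((\varphi\to\chi)\to(\varphi\to(\psi\land\chi)))$; $\bot\to\varphi$; $\Box(\varphi\to\psi)\to(\Box\varphi\to\Box\psi)$;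 $(\Box\varphi\to\varphi)\to\varphi$. A sequent is $\Gamma\Rightarrow\chi$ with $\Gamma$ a finite multiset of formulas and $\chi$ a formula. The sequent calculus $\mathsf{G4iSLt}$ has the following rules, where $p$ is a propositional variable and $\Phi$ always denotes a multiset containing no boxed formula: (⊥L) $\bot,\Gamma\Rightarrow\chi$ (no premise); (IdP) $\Gamma,p\Rightarrow p$ (no premise); (∧L) from $\Gamma,\varphi,\psi\Rightarrow\chi$ infer $\Gamma,\varphi\land\psi\Rightarrow\chi$; (∧R) from $\Gamma\Rightarrow\varphi$ and $\Gamma\Rightarrow\psi$ infer $\Gamma\Rightarrow\varphi\land\psi$; (∨L) from $\Gamma,\varphi\Rightarrow\chi$ and $\Gamma,\psi\Rightarrow\chi$ infer $\Gamma,\varphi\lor\psi\Rightarrow\chi$; (∨R$_i$), $i\in\{1,2\}$: from $\Gamma\Rightarrow\varphi_i$ infer $\Gamma\Rightarrow\varphi_1\lor\varphi_2$; (p→L) from $\Gamma,p,\varphi\Rightarrow\chi$ infer $\Gamma,p,p\to\varphi\Rightarrow\chi$; (→R) from $\Gamma,\varphi\Rightarrow\psi$ infer $\Gamma\Rightarrow\varphi\to\psi$; (□→L) from $\Phi,\Gamma,\psi,\Box\varphi\Rightarrow\varphi$ and $\Phi,\Box\Gamma,\psi\Rightarrow\chi$ infer $\Phi,\Box\Gamma,\Box\varphi\to\psi\Rightarrow\chi$; (SLtR) from $\Phi,\Gamma,\Box\varphi\Rightarrow\varphi$ infer $\Phi,\Box\Gamma\Rightarrow\Box\varphi$; (∧→L)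 from $\Gamma,\varphi\to(\psi\to\chi)\Rightarrow\delta$ infer $\Gamma,(\varphi\land\psi)\to\chi\Rightarrow\delta$; (∨→L) from $\Gamma,\varphi\to\chi,\psi\to\chi\Rightarrow\delta$ infer $\Gamma,(\varphi\lor\psi)\to\chi\Rightarrow\delta$; (→→L) from $\Gamma,\psi\to\chi\Rightarrow\varphi\to\psi$ and $\Gamma,\chi\Rightarrow\delta$ infer $\Gamma,(\varphi\to\psi)\to\chi\Rightarrow\delta$. A proof of a sequent $S$ is a finite tree of sequents with root $S$ in which each interior node together with its children forms an instance of a rule (conclusion, premises) and each leaf is the conclusion of a premise-free rule; $S$ is provable if it has a proof. -}

module Defs where

open import Data.List.Base using (List; []; _∷_; _++_; map)
open import Data.List.Relation.Binary.Permutation.Propositional using (_↭_)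
open import Data.List.Relation.Unary.All using (All)
open import Data.Nat.Base using (ℕ)
open import Level using (0ℓ)
open import Relation.Nullary.Negation using (¬_)
open import Relation.Unary using (Pred; _∈_; ∅)

infixr 5 _⊃_
infixr 6 _∨_
infixr 7 _∧_
infix  8 □_

data Formula : Set where
  var         : ℕ → Formula
  ⊥           : Formula
  _∧_ _∨_ _⊃_ : Formula → Formula → Formula
  □_          : Formula → Formula

data Boxed : Formula → Set where
  boxed : (φ : Formula) → Boxed (□ φ)

private
  variable
    p         : ℕ
    φ ψ χ δ   : Formula
    Γ Δ Φ     : List Formula

data Axiom : Pred Formula 0ℓ where
  K⊃   : Axiom (φ ⊃ (ψ ⊃ φ))
  S⊃   : Axiom ((φ ⊃ (ψ ⊃ χ)) ⊃ ((φ ⊃ ψ) ⊃ (φ ⊃ χ)))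
  ∨I₁  : Axiom (φ ⊃ (φ ∨ ψ))
  ∨I₂  : Axiom (ψ ⊃ (φ ∨ ψ))
  ∨E   : Axiom ((φ ⊃ χ) ⊃ ((ψ ⊃ χ) ⊃ ((φ ∨ ψ) ⊃ χ)))
  ∧E₁  : Axiom ((φ ∧ ψ) ⊃ φ)
  ∧E₂  : Axiom ((φ ∧ ψ) ⊃ ψ)
  ∧I   : Axiom ((φ ⊃ ψ) ⊃ ((φ ⊃ χ) ⊃ (φ ⊃ (ψ ∧ χ))))
  ⊥E   : Axiom (⊥ ⊃ φ)
  K□   : Axiom (□ (φ ⊃ ψ) ⊃ (□ φ ⊃ □ ψ))
  SL   : Axiom ((□ φ ⊃ φ) ⊃ φ)

infix 3 _⊢iSLH_

data _⊢iSLH_ (Θ : Pred Formula 0ℓ) : Formula → Set where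
  Ax  : Axiom φ → Θ ⊢iSLH φ
  El  : φ ∈ Θ → Θ ⊢iSLH φ
  Nec : ∅ ⊢iSLH φ → Θ ⊢iSLH □ φ
  MP  : Θ ⊢iSLH φ → Θ ⊢iSLH φ ⊃ ψ → Θ ⊢iSLH ψ

infix 3 _⇒_

-- Antecedents are finite multisets, represented by lists up to permutation.
record Sequent : Set where
  constructor _⇒_
  field
    antecedent : List Formula
    succedent  : Formula

-- Proof trees.  Where a rule imposes a shape on the antecedent of its
-- conclusion, that antecedent is an arbitrary list Δ which has this shape as a
-- multiset, so that no exchange rule is needed.
data G4iSLt : Sequent → Set where
  ⊥L   : Δ ↭ ⊥ ∷ Γ →
         G4iSLt (Δ ⇒ χ)
  IdP  : Δ ↭ var p ∷ Γ →
         G4iSLt (Δ ⇒ var p)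
  ∧L   : Δ ↭ (φ ∧ ψ) ∷ Γ →
         G4iSLt (φ ∷ ψ ∷ Γ ⇒ χ) →
         G4iSLt (Δ ⇒ χ)
  ∧R   : G4iSLt (Γ ⇒ φ) →
         G4iSLt (Γ ⇒ ψ) →
         G4iSLt (Γ ⇒ φ ∧ ψ)
  ∨L   : Δ ↭ (φ ∨ ψ) ∷ Γ →
         G4iSLt (φ ∷ Γ ⇒ χ) →
         G4iSLt (ψ ∷ Γ ⇒ χ) →
         G4iSLt (Δ ⇒ χ)
  ∨R₁  : G4iSLt (Γ ⇒ φ) →
         G4iSLt (Γ ⇒ φ ∨ ψ)
  ∨R₂  : G4iSLt (Γ ⇒ ψ) →
         G4iSLt (Γ ⇒ φ ∨ ψ)
  p→L  : Δ ↭ (var p ⊃ φ) ∷ var p ∷ Γ →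
         G4iSLt (φ ∷ var p ∷ Γ ⇒ χ) →
         G4iSLt (Δ ⇒ χ)
  →R   : G4iSLt (φ ∷ Γ ⇒ ψ) →
         G4iSLt (Γ ⇒ φ ⊃ ψ)
  □→L  : All (λ θ → ¬ Boxed θ) Φ →
         Δ ↭ (□ φ ⊃ ψ) ∷ Φ ++ map □_ Γ →
         G4iSLt (□ φ ∷ ψ ∷ Φ ++ Γ ⇒ φ) →
         G4iSLt (ψ ∷ Φ ++ map □_ Γ ⇒ χ) →
         G4iSLt (Δ ⇒ χ)
  SLtR : All (λ θ → ¬ Boxed θ) Φ →
         Δ ↭ Φ ++ map □_ Γ →
         G4iSLt (□ φ ∷ Φ ++ Γ ⇒ φ) →
         G4iSLt (Δ ⇒ □ φ)
  ∧→L  : Δ ↭ ((φ ∧ ψ) ⊃ χ) ∷ Γ →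
         G4iSLt ((φ ⊃ (ψ ⊃ χ)) ∷ Γ ⇒ δ) →
         G4iSLt (Δ ⇒ δ)
  ∨→L  : Δ ↭ ((φ ∨ ψ) ⊃ χ) ∷ Γ →
         G4iSLt ((φ ⊃ χ) ∷ (ψ ⊃ χ) ∷ Γ ⇒ δ) →
         G4iSLt (Δ ⇒ δ)
  →→L  : Δ ↭ ((φ ⊃ ψ) ⊃ χ) ∷ Γ →
         G4iSLt ((ψ ⊃ χ) ∷ Γ ⇒ φ ⊃ ψ) →
         G4iSLt (χ ∷ Γ ⇒ δ) →
         G4iSLt (Δ ⇒ δ)

{-# OPTIONS --safe #-}

-- A derivation in the sequent calculus translates into the Hilbert calculus by
-- the deduction theorem; the modal rules become sound because the strong Löb
-- axiom proves φ ⊃ □ φ.  Cut is never eliminated syntactically for the converse.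
-- Instead every sequent has either a proof or a finite countermodel: one
-- searches backwards, each premise being smaller in the sum of 5 ^ weight over
-- the antecedent and two copies of the succedent, and glues the countermodels of
-- the underivable premises under a fresh root.  The Hilbert calculus is sound
-- for these models, so its theorems have no countermodel.
module Submission where

open import Defs
open import Data.Empty using (⊥-elim)
open import Data.List.Base using (List; []; _∷_; _++_; map; length; [_])
open import Data.List.Membership.Propositional using (_∈_; _∉_; find)
open import Data.List.Membership.Propositional.Properties
  using (∈-∃++; ∈-++⁻; ∈-++⁺ˡ; ∈-++⁺ʳ; ∈-map⁺; ∈-map⁻)
open import Data.List.Properties using (map-++)
open import Data.List.Relation.Binary.Permutation.Propositional
  using (_↭_; ↭-refl; ↭-sym; ↭-trans; ↭-reflexive; prep)
open import Data.List.Relation.Binary.Permutation.Propositional.Properties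
  using (∈-resp-↭; All-resp-↭; shift)
  renaming (map⁺ to ↭-map⁺)
open import Data.List.Relation.Binary.Subset.Propositional using (_⊆_)
open import Data.List.Relation.Binary.Subset.Propositional.Properties
  using (Any-resp-⊆; xs⊆xs++ys; xs⊆ys++xs)
open import Data.List.Relation.Unary.All as All using (All; []; _∷_)
open import Data.List.Relation.Unary.All.Properties using (++⁺; ++⁻ˡ; ++⁻ʳ)
open import Data.List.Relation.Unary.Any using (Any; here; there; any?)
open import Data.Nat.Base using (ℕ; suc; _+_; _*_; _^_; _≤_; _<_; z≤n; s≤s)
open import Data.Nat.Induction using (<-wellFounded)
open import Data.Nat.ListAction using (sum)
open import Data.Nat.ListAction.Properties using (sum-++; sum-↭)
open import Data.Nat.Properties
open import Data.Product.Base using (∃₂; ∃-syntax; _×_; _,_; proj₁; proj₂)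
open import Data.Sum.Base using (_⊎_; inj₁; inj₂; [_,_]′)
open import Function.Base using (_∘_)
open import Function.Bundles using (_⇔_; mk⇔)
open import Induction.WellFounded using (Acc; acc)
open import Level using (0ℓ)
open import Relation.Binary.PropositionalEquality using (_≡_; refl; sym; trans; cong; module ≡-Reasoning)
open import Relation.Nullary using (¬_; Dec; yes; no)
open import Relation.Nullary.Decidable using (map′)
open import Relation.Unary using (Pred; ∅)

private
  variable
    φ ψ χ : Formula
    Γ Δ Π : List Formula
    Θ Θ′  : Pred Formula 0ℓ

-- Soundness for the Hilbert calculus

infix 3 _⊢_

_⊢_ : List Formula → Formula → Set
Γ ⊢ φ = (_∈ Γ) ⊢iSLH φ

bind : Θ ⊢iSLH φ → (∀ {ψ} → Θ ψ → Θ′ ⊢iSLH ψ) → Θ′ ⊢iSLH φ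
bind (Ax a)   f = Ax a
bind (El x)   f = f x
bind (Nec d)  f = Nec d
bind (MP d e) f = MP (bind d f) (bind e f)

weaken : Γ ⊢ φ → ψ ∷ Γ ⊢ φ
weaken d = bind d (El ∘ there)

⊢-↭ : Δ ↭ Γ → Γ ⊢ φ → Δ ⊢ φ
⊢-↭ p d = bind d (El ∘ ∈-resp-↭ (↭-sym p))

K-rule : Θ ⊢iSLH φ → Θ ⊢iSLH ψ ⊃ φ
K-rule d = MP d (Ax K⊃)

identity : Θ ⊢iSLH φ ⊃ φ
identity {φ = φ} = MP (Ax K⊃) (MP (Ax (K⊃ {ψ = φ ⊃ φ})) (Ax S⊃))

deduction : φ ∷ Γ ⊢ ψ → Γ ⊢ φ ⊃ ψ
deduction (Ax a)           = K-rule (Ax a)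
deduction (El (here refl)) = identity
deduction (El (there x))   = K-rule (El x)
deduction (Nec d)          = K-rule (Nec d)
deduction (MP d e)         = MP (deduction d) (MP (deduction e) (Ax S⊃))

cut : Γ ⊢ φ → φ ∷ Γ ⊢ ψ → Γ ⊢ ψ
cut d e = MP d (deduction e)

hyp₀ : φ ∷ Γ ⊢ φ
hyp₀ = El (here refl)

hyp₁ : ψ ∷ φ ∷ Γ ⊢ φ
hyp₁ = El (there (here refl))

fst : Θ ⊢iSLH φ ∧ ψ → Θ ⊢iSLH φ
fst d = MP d (Ax ∧E₁)

snd : Θ ⊢iSLH φ ∧ ψ → Θ ⊢iSLH ψ
snd d = MP d (Ax ∧E₂)

pair : Θ ⊢iSLH φ → Θ ⊢iSLH ψ → Θ ⊢iSLH φ ∧ ψ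
pair d e = MP d (MP (K-rule e) (MP identity (Ax ∧I)))

cases : Θ ⊢iSLH φ ∨ ψ → Θ ⊢iSLH φ ⊃ χ → Θ ⊢iSLH ψ ⊃ χ → Θ ⊢iSLH χ
cases d e f = MP d (MP f (MP e (Ax ∨E)))

□-app : Θ ⊢iSLH □ (φ ⊃ ψ) → Θ ⊢iSLH □ φ → Θ ⊢iSLH □ ψ
□-app d e = MP e (MP d (Ax K□))

löb : □ φ ∷ Γ ⊢ φ → Γ ⊢ φ
löb d = MP (deduction d) (Ax SL)

-- Strong Löb applied to φ ∧ □ φ.
□-intro : Γ ⊢ φ → Γ ⊢ □ φ
□-intro {φ = φ} d = snd (löb {φ ∧ □ φ} (pair (weaken d) (□-app (Nec (Ax ∧E₁)) hyp₀)))

□-map : ∀ Γ → Γ ⊢ φ → (∀ {ψ} → ψ ∈ Γ → Δ ⊢ □ ψ) → Δ ⊢ □ φ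
□-map []      d f = Nec (bind d λ ())
□-map (ψ ∷ Γ) d f = □-app (□-map Γ (deduction d) (f ∘ there)) (f (here refl))

-- The members of Φ pass under the box by `□-intro`, an effect of strong Löb; those of Γ are already
-- boxed among the hypotheses.
□-unbox : ∀ Φ Γ → Φ ++ Γ ⊢ φ → Φ ++ map □_ Γ ⊢ □ φ
□-unbox Φ Γ d = □-map (Φ ++ Γ) d λ x →
  [ (λ y → □-intro (El (∈-++⁺ˡ y))) , (λ y → El (∈-++⁺ʳ Φ (∈-map⁺ □_ y))) ]′ (∈-++⁻ Φ x)

G4⇒Hilbert : G4iSLt (Γ ⇒ χ) → Γ ⊢ χ
G4⇒Hilbert (⊥L p)        = ⊢-↭ p (MP hyp₀ (Ax ⊥E))
G4⇒Hilbert (IdP p)       = ⊢-↭ p hyp₀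
G4⇒Hilbert (∧L p d)      = ⊢-↭ p (bind (G4⇒Hilbert d) λ where
  (here refl)         → fst hyp₀
  (there (here refl)) → snd hyp₀
  (there (there x))   → El (there x))
G4⇒Hilbert (∧R d e)      = pair (G4⇒Hilbert d) (G4⇒Hilbert e)
G4⇒Hilbert (∨L p d e)    = ⊢-↭ p
  (cases hyp₀ (weaken (deduction (G4⇒Hilbert d))) (weaken (deduction (G4⇒Hilbert e))))
G4⇒Hilbert (∨R₁ d)       = MP (G4⇒Hilbert d) (Ax ∨I₁)
G4⇒Hilbert (∨R₂ d)       = MP (G4⇒Hilbert d) (Ax ∨I₂)
G4⇒Hilbert (p→L p d)     = ⊢-↭ p (bind (G4⇒Hilbert d) λ where
  (here refl) → MP hyp₁ hyp₀
  (there x)   → El (there x))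
G4⇒Hilbert (→R d)        = deduction (G4⇒Hilbert d)
G4⇒Hilbert (□→L {Φ = Φ} {φ = φ} {ψ} {Γ} _ p d e) = ⊢-↭ p (MP (MP □φ hyp₀) (weaken (deduction (G4⇒Hilbert e))))
  where
  □φ : (□ φ ⊃ ψ) ∷ Φ ++ map □_ Γ ⊢ □ φ
  -- The implication is treated as one more unboxed hypothesis, so it survives under the box, where
  -- the Löb hypothesis □ φ turns it into ψ.
  □φ = □-unbox (_ ∷ Φ) Γ (löb (bind (G4⇒Hilbert d) λ where
    (here refl)         → hyp₀
    (there (here refl)) → MP hyp₀ hyp₁
    (there (there x))   → El (there (there x))))
G4⇒Hilbert (SLtR {Φ = Φ} {Γ = Γ} _ p d) = ⊢-↭ p (□-unbox Φ Γ (löb (G4⇒Hilbert d)))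
G4⇒Hilbert (∧→L p d)     = ⊢-↭ p (bind (G4⇒Hilbert d) λ where
  (here refl) → deduction (deduction (MP (pair hyp₁ hyp₀) (El (there (there (here refl))))))
  (there x)   → El (there x))
G4⇒Hilbert (∨→L p d)     = ⊢-↭ p (bind (G4⇒Hilbert d) λ where
  (here refl)         → deduction (MP (MP hyp₀ (Ax ∨I₁)) hyp₁)
  (there (here refl)) → deduction (MP (MP hyp₀ (Ax ∨I₂)) hyp₁)
  (there (there x))   → El (there x))
G4⇒Hilbert (→→L p d e)   = ⊢-↭ p (cut
  (MP (bind (G4⇒Hilbert d) λ where
    -- Since ψ entails φ ⊃ ψ, the principal formula yields ψ ⊃ χ.
    (here refl) → deduction (MP (K-rule hyp₀) hyp₁)
    (there x)   → El (there x)) hyp₀)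
  (bind (G4⇒Hilbert e) λ where
    (here refl) → hyp₀
    (there x)   → El (there (there x))))

-- Kripke models

-- A world carries a list of formulas, of which only the variables matter, its
-- merely intuitionistic children and its modal children.
data World : Set where
  node : List Formula → List World → List World → World

label : World → List Formula
label (node Γ _ _) = Γ

private
  variable
    t u v  : World
    ts us ts′ us′ : List World

infix 4 _≼_ _◁_

data _≼_ : World → World → Set where
  ≼-refl : t ≼ t
  ≼-int  : t ∈ ts → t ≼ u → node Γ ts us ≼ u
  ≼-mod  : t ∈ us → t ≼ u → node Γ ts us ≼ u

-- The path from t to u must cross a modal edge somewhere, not necessarily first. Hence ◁ absorbs ≼
-- on the left, which makes □ persistent, and lies inside ≼, which validates φ ⊃ □ φ.
data _◁_ : World → World → Set where
  ◁-int : t ∈ ts → t ◁ u → node Γ ts us ◁ u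
  ◁-mod : t ∈ us → t ≼ u → node Γ ts us ◁ u

≼-trans : t ≼ u → u ≼ v → t ≼ v
≼-trans ≼-refl      q = q
≼-trans (≼-int x p) q = ≼-int x (≼-trans p q)
≼-trans (≼-mod x p) q = ≼-mod x (≼-trans p q)

◁⇒≼ : t ◁ u → t ≼ u
◁⇒≼ (◁-int x r) = ≼-int x (◁⇒≼ r)
◁⇒≼ (◁-mod x p) = ≼-mod x p

≼-◁-trans : t ≼ u → u ◁ v → t ◁ v
≼-◁-trans ≼-refl      r = r
≼-◁-trans (≼-int x p) r = ◁-int x (≼-◁-trans p r)
≼-◁-trans (≼-mod x p) r = ◁-mod x (≼-trans p (◁⇒≼ r))

infix 4 _⊩_ _⊩*_

-- Labels need not grow along ≼; quantifying over the future makes forcing of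
-- variables persistent anyway.
_⊩_ : World → Formula → Set
t ⊩ var p = ∀ {u} → t ≼ u → var p ∈ label u
t ⊩ ⊥     = Data.Empty.⊥
t ⊩ φ ∧ ψ = t ⊩ φ × t ⊩ ψ
t ⊩ φ ∨ ψ = t ⊩ φ ⊎ t ⊩ ψ
t ⊩ φ ⊃ ψ = ∀ {u} → t ≼ u → u ⊩ φ → u ⊩ ψ
t ⊩ □ φ   = ∀ {u} → t ◁ u → u ⊩ φ

_⊩*_ : World → List Formula → Set
t ⊩* Γ = All (t ⊩_) Γ

persistent : ∀ φ → t ≼ u → t ⊩ φ → u ⊩ φ
persistent (var p) t≼u f        = f ∘ ≼-trans t≼u
persistent (φ ∧ ψ) t≼u (f , g)  = persistent φ t≼u f , persistent ψ t≼u g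
persistent (φ ∨ ψ) t≼u (inj₁ f) = inj₁ (persistent φ t≼u f)
persistent (φ ∨ ψ) t≼u (inj₂ g) = inj₂ (persistent ψ t≼u g)
persistent (φ ⊃ ψ) t≼u f        = f ∘ ≼-trans t≼u
persistent (□ φ)   t≼u f        = f ∘ ≼-◁-trans t≼u

⊩-□ : ∀ φ → t ⊩ φ → t ⊩ □ φ
⊩-□ φ f t◁u = persistent φ (◁⇒≼ t◁u) f

mutual
  -- Induction on the tree t, with u ranging over its worlds: every modal successor of the root lies
  -- in the subtree of a child, where φ holds by induction, so the root forces □ φ. Finiteness of
  -- trees supplies the converse well-foundedness behind Löb. `⊩-SL-any` walks along the children to
  -- keep the recursion structural.
  ⊩-SL : ∀ φ → t ≼ u → u ⊩ □ φ ⊃ φ → u ⊩ φ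
  ⊩-SL {t = node _ ts us} φ ≼-refl f = f ≼-refl λ where
    r@(◁-int x q) → ⊩-SL-any φ ts x (◁⇒≼ q) (f ∘ ≼-trans (◁⇒≼ r))
    r@(◁-mod x q) → ⊩-SL-any φ us x q (f ∘ ≼-trans (◁⇒≼ r))
  ⊩-SL {t = node _ ts us} φ (≼-int x q) f = ⊩-SL-any φ ts x q f
  ⊩-SL {t = node _ ts us} φ (≼-mod x q) f = ⊩-SL-any φ us x q f

  ⊩-SL-any : ∀ φ ts → t ∈ ts → t ≼ u → u ⊩ □ φ ⊃ φ → u ⊩ φ
  ⊩-SL-any φ (t ∷ ts) (here refl) q f = ⊩-SL φ q f
  ⊩-SL-any φ (t ∷ ts) (there x)   q f = ⊩-SL-any φ ts x q f

⊩-axiom : Axiom φ → t ⊩ φ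
⊩-axiom (K⊃ {φ})   _ x p _   = persistent φ p x
⊩-axiom S⊃         _ f p g q x = f (≼-trans p q) x ≼-refl (g q x)
⊩-axiom ∨I₁        _ x       = inj₁ x
⊩-axiom ∨I₂        _ x       = inj₂ x
⊩-axiom ∨E         _ f p g q = [ f (≼-trans p q) , g q ]′
⊩-axiom ∧E₁        _         = proj₁
⊩-axiom ∧E₂        _         = proj₂
⊩-axiom ∧I         _ f p g q x = f (≼-trans p q) x , g q x
⊩-axiom ⊥E         _         = ⊥-elim
⊩-axiom K□         _ f p g r = f (≼-◁-trans p r) ≼-refl (g r)
⊩-axiom (SL {φ})   _         = ⊩-SL φ ≼-refl

Hilbert⇒⊩ : ∅ ⊢iSLH φ → t ⊩ φ
Hilbert⇒⊩ (Ax a)   = ⊩-axiom a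
Hilbert⇒⊩ (Nec d)  = λ _ → Hilbert⇒⊩ d
Hilbert⇒⊩ (MP d e) = Hilbert⇒⊩ e ≼-refl (Hilbert⇒⊩ d)

-- The termination measure

-- Conjunction counts 2 because φ ⊃ ψ ⊃ χ has one connective more than φ and ψ joined in a single
-- antecedent would save; with 2 the curried form is lighter by exactly 1.
weight : Formula → ℕ
weight (var _) = 0
weight ⊥       = 0
weight (φ ∧ ψ) = 2 + (weight φ + weight ψ)
weight (φ ∨ ψ) = 1 + (weight φ + weight ψ)
weight (φ ⊃ ψ) = 1 + (weight φ + weight ψ)
weight (□ φ)   = 1 + weight φ

infix 4 _≺_

_≺_ : Formula → Formula → Set
φ ≺ ψ = weight φ < weight ψ

cost : Formula → ℕ
cost φ = 5 ^ weight φ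

size : List Formula → ℕ
size Γ = sum (map cost Γ)

-- The succedent counts twice because `SLtR` puts □ φ itself on the left, which would use up a
-- single copy entirely.
measure : Sequent → ℕ
measure (Γ ⇒ χ) = size Γ + (cost χ + cost χ)

size-++ : ∀ Γ Δ → size (Γ ++ Δ) ≡ size Γ + size Δ
size-++ Γ Δ = trans (cong sum (map-++ cost Γ Δ)) (sum-++ (map cost Γ) (map cost Δ))

size-↭ : Γ ↭ Δ → size Γ ≡ size Δ
size-↭ p = sum-↭ (↭-map⁺ cost p)

cost>0 : ∀ φ → 0 < cost φ
cost>0 φ = m^n>0 5 (weight φ)

-- A lighter formula costs at most a fifth of `cost φ`.
size-≺ : ∀ φ → All (_≺ φ) Γ → 5 * size Γ ≤ length Γ * cost φ
size-≺ φ []                  = z≤n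
size-≺ {ψ ∷ Γ} φ (ψ≺φ ∷ Γ≺φ) = begin
  5 * (cost ψ + size Γ)           ≡⟨ *-distribˡ-+ 5 (cost ψ) (size Γ) ⟩
  5 ^ suc (weight ψ) + 5 * size Γ ≤⟨ +-mono-≤ (^-monoʳ-≤ 5 ψ≺φ) (size-≺ φ Γ≺φ) ⟩
  cost φ + length Γ * cost φ      ∎
  where open ≤-Reasoning

-- Each rule replaces a formula by at most four smaller ones, whence the base 5.
size<cost : ∀ Γ φ → length Γ ≤ 4 → All (_≺ φ) Γ → size Γ < cost φ
size<cost Γ φ l Γ≺φ = *-cancelˡ-< 5 _ _ (begin-strict
  5 * size Γ         ≤⟨ size-≺ φ Γ≺φ ⟩
  length Γ * cost φ  ≤⟨ *-monoˡ-≤ (cost φ) l ⟩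
  4 * cost φ         <⟨ m<n+m (4 * cost φ) (cost>0 φ) ⟩
  5 * cost φ         ∎)
  where open ≤-Reasoning

antecedent-smaller : ∀ Ξ χ → Γ ↭ φ ∷ Π → length Ξ ≤ 4 → All (_≺ φ) Ξ →
                     measure (Ξ ++ Π ⇒ χ) < measure (Γ ⇒ χ)
antecedent-smaller {Γ} {φ} {Π} Ξ χ p l Ξ≺φ = +-monoˡ-< (cost χ + cost χ) (begin-strict
  size (Ξ ++ Π)   ≡⟨ size-++ Ξ Π ⟩
  size Ξ + size Π <⟨ +-monoˡ-< (size Π) (size<cost Ξ φ l Ξ≺φ) ⟩
  cost φ + size Π ≡⟨ sym (size-↭ p) ⟩
  size Γ          ∎)
  where open ≤-Reasoning

measure-++ : ∀ Ξ Δ ψ → measure (Ξ ++ Δ ⇒ ψ) ≡ size Δ + size (ψ ∷ ψ ∷ Ξ)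
measure-++ Ξ Δ ψ = begin
  size (Ξ ++ Δ) + (cost ψ + cost ψ)     ≡⟨ cong (_+ (cost ψ + cost ψ)) (size-++ Ξ Δ) ⟩
  size Ξ + size Δ + (cost ψ + cost ψ)   ≡⟨ cong (_+ (cost ψ + cost ψ)) (+-comm (size Ξ) (size Δ)) ⟩
  size Δ + size Ξ + (cost ψ + cost ψ)   ≡⟨ +-assoc (size Δ) (size Ξ) _ ⟩
  size Δ + (size Ξ + (cost ψ + cost ψ)) ≡⟨ cong (size Δ +_) (+-comm (size Ξ) _) ⟩
  size Δ + (cost ψ + cost ψ + size Ξ)   ≡⟨ cong (size Δ +_) (+-assoc (cost ψ) (cost ψ) _) ⟩
  size Δ + size (ψ ∷ ψ ∷ Ξ)             ∎
  where open ≡-Reasoning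

-- The principal formula alone pays for Ξ and both copies of the new succedent, however cheap χ is.
-- In `→→L` the list Δ is Π; in `□→L` it is Π with outer boxes stripped.
left-premise-smaller : ∀ Ξ Δ ψ χ → Γ ↭ φ ∷ Π → size Δ ≤ size Π →
                       length (ψ ∷ ψ ∷ Ξ) ≤ 4 → All (_≺ φ) (ψ ∷ ψ ∷ Ξ) →
                       measure (Ξ ++ Δ ⇒ ψ) < measure (Γ ⇒ χ)
left-premise-smaller {Γ} {φ} {Π} Ξ Δ ψ χ p Δ≤Π l small = begin-strict
  measure (Ξ ++ Δ ⇒ ψ)       ≡⟨ measure-++ Ξ Δ ψ ⟩
  size Δ + size (ψ ∷ ψ ∷ Ξ)  <⟨ +-mono-≤-< Δ≤Π (size<cost (ψ ∷ ψ ∷ Ξ) φ l small) ⟩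
  size Π + cost φ            ≡⟨ +-comm (size Π) (cost φ) ⟩
  cost φ + size Π            ≡⟨ sym (size-↭ p) ⟩
  size Γ                     ≤⟨ m≤m+n (size Γ) _ ⟩
  measure (Γ ⇒ χ)            ∎
  where open ≤-Reasoning

right-premise-smaller : ∀ Ξ Δ Γ ψ χ → size Δ ≤ size Γ → size (ψ ∷ ψ ∷ Ξ) < cost χ + cost χ →
                        measure (Ξ ++ Δ ⇒ ψ) < measure (Γ ⇒ χ)
right-premise-smaller Ξ Δ Γ ψ χ Δ≤Γ small = begin-strict
  measure (Ξ ++ Δ ⇒ ψ)       ≡⟨ measure-++ Ξ Δ ψ ⟩
  size Δ + size (ψ ∷ ψ ∷ Ξ)  <⟨ +-mono-≤-< Δ≤Γ small ⟩
  measure (Γ ⇒ χ)            ∎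
  where open ≤-Reasoning

subformula-smaller : ∀ Ξ Γ ψ χ → length (ψ ∷ ψ ∷ Ξ) ≤ 4 → All (_≺ χ) (ψ ∷ ψ ∷ Ξ) →
                     measure (Ξ ++ Γ ⇒ ψ) < measure (Γ ⇒ χ)
subformula-smaller Ξ Γ ψ χ l small =
  right-premise-smaller Ξ Γ Γ ψ χ ≤-refl (m≤n⇒m≤n+o (cost χ) (size<cost (ψ ∷ ψ ∷ Ξ) χ l small))

-- The new □ φ on the left cancels one copy of the old succedent, and the other copy outweighs the
-- two copies of φ.
□-premise-smaller : ∀ Δ Γ φ → size Δ ≤ size Γ → measure (□ φ ∷ Δ ⇒ φ) < measure (Γ ⇒ □ φ)
□-premise-smaller Δ Γ φ Δ≤Γ = right-premise-smaller [ □ φ ] Δ Γ φ (□ φ) Δ≤Γ (begin-strict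
  cost φ + (cost φ + (cost (□ φ) + 0)) ≡⟨ sym (+-assoc (cost φ) (cost φ) _) ⟩
  cost φ + cost φ + (cost (□ φ) + 0)   ≡⟨ cong (cost φ + cost φ +_) (+-identityʳ (cost (□ φ))) ⟩
  cost φ + cost φ + cost (□ φ)         ≡⟨ cong (λ n → cost φ + n + cost (□ φ)) (sym (+-identityʳ (cost φ))) ⟩
  size (φ ∷ φ ∷ []) + cost (□ φ)       <⟨ +-monoˡ-< (cost (□ φ)) (size<cost (φ ∷ φ ∷ []) (□ φ) (m≤m+n 2 2) (n<1+n _ ∷ n<1+n _ ∷ [])) ⟩
  cost (□ φ) + cost (□ φ)              ∎)
  where open ≤-Reasoning

m<1+m+n : ∀ m n → m < 1 + (m + n)
m<1+m+n m n = s≤s (m≤m+n m n)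

n<1+m+n : ∀ m n → n < 1 + (m + n)
n<1+m+n m n = s≤s (m≤n+m n m)

-- Search for a proof or a countermodel

extract : φ ∈ Γ → ∃[ Π ] Γ ↭ φ ∷ Π
extract x with Δ , Π , eq ← ∈-∃++ x = Δ ++ Π , ↭-trans (↭-reflexive eq) (shift _ Δ Π)

var∈? : ∀ p Γ → Dec (var p ∈ Γ)
var∈? p = any? λ where
  (var q) → map′ (cong var) (λ where refl → refl) (p ≟ q)
  ⊥       → no λ ()
  (_ ∧ _) → no λ ()
  (_ ∨ _) → no λ ()
  (_ ⊃ _) → no λ ()
  (□ _)   → no λ ()

Unboxing : List Formula → List Formula → List Formula → Set
Unboxing Γ Φ Ψ = All (λ φ → ¬ Boxed φ) Φ × Γ ↭ Φ ++ map □_ Ψ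

unboxing-∷ : ¬ Boxed φ → ∃₂ (Unboxing Γ) → ∃₂ (Unboxing (φ ∷ Γ))
unboxing-∷ nb (Φ , Ψ , nbs , p) = _ ∷ Φ , Ψ , nb ∷ nbs , prep _ p

unboxing : ∀ Γ → ∃₂ (Unboxing Γ)
unboxing []            = [] , [] , [] , ↭-refl
unboxing (var _ ∷ Γ)   = unboxing-∷ (λ ()) (unboxing Γ)
unboxing (⊥ ∷ Γ)       = unboxing-∷ (λ ()) (unboxing Γ)
unboxing (_ ∧ _ ∷ Γ)   = unboxing-∷ (λ ()) (unboxing Γ)
unboxing (_ ∨ _ ∷ Γ)   = unboxing-∷ (λ ()) (unboxing Γ)
unboxing ((_ ⊃ _) ∷ Γ) = unboxing-∷ (λ ()) (unboxing Γ)
unboxing (□ φ ∷ Γ) with Φ , Ψ , nbs , p ← unboxing Γ =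
  Φ , φ ∷ Ψ , nbs , ↭-trans (prep _ p) (↭-sym (shift _ Φ (map □_ Ψ)))

size-□ : ∀ Γ → size Γ ≤ size (map □_ Γ)
size-□ []      = z≤n
size-□ (φ ∷ Γ) = +-mono-≤ (^-monoʳ-≤ 5 (n≤1+n (weight φ))) (size-□ Γ)

size-unboxing : ∀ Φ Ψ → Γ ↭ Φ ++ map □_ Ψ → size (Φ ++ Ψ) ≤ size Γ
size-unboxing {Γ} Φ Ψ p = begin
  size (Φ ++ Ψ)              ≡⟨ size-++ Φ Ψ ⟩
  size Φ + size Ψ            ≤⟨ +-monoʳ-≤ (size Φ) (size-□ Ψ) ⟩
  size Φ + size (map □_ Ψ)   ≡⟨ sym (size-++ Φ (map □_ Ψ)) ⟩
  size (Φ ++ map □_ Ψ)       ≡⟨ sym (size-↭ p) ⟩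
  size Γ                     ∎
  where open ≤-Reasoning

-- Gluing countermodels under a fresh root

infix 4 _⊩⁺_

-- The demand on a modal child: the root reaches it along ◁, so for the root to force □ ψ the child
-- must force ψ as well.
_⊩⁺_ : World → Formula → Set
t ⊩⁺ φ = t ⊩ φ × (∀ ψ → φ ≡ □ ψ → t ⊩ ψ)

-- On Φ the extra demand is void; on the boxed part, forcing ψ is enough, since it entails □ ψ.
⊩⁺-unboxing : ∀ Φ Ψ → Unboxing Γ Φ Ψ → t ⊩* Φ ++ Ψ → All (t ⊩⁺_) Γ
⊩⁺-unboxing {t = t} Φ Ψ (nbs , p) f = All-resp-↭ (↭-sym p) (All.tabulate λ x →
  [ (λ y → All.lookup f (∈-++⁺ˡ y) , λ { ψ refl → ⊥-elim (All.lookup nbs y (boxed ψ)) }) , boxes ]′ (∈-++⁻ Φ x))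
  where
  boxes : φ ∈ map □_ Ψ → t ⊩⁺ φ
  boxes y with ψ , z , refl ← ∈-map⁻ □_ y =
    let g = All.lookup f (∈-++⁺ʳ Φ z) in (λ {u} → ⊩-□ ψ g {u}) , λ { _ refl → g }

Refutation : List Formula → Formula → Set
Refutation Γ χ = ∃[ t ] t ⊩* Γ × ¬ t ⊩ χ

Result : List Formula → Formula → Set
Result Γ χ = G4iSLt (Γ ⇒ χ) ⊎ Refutation Γ χ

Children : List Formula → List World → List World → Set
Children Γ ts us = All (_⊩* Γ) ts × All (λ u → All (u ⊩⁺_) Γ) us

-- The children ts, us of a root labelled Γ make it force φ, given φ ∈ Γ.
data Saturatedˡ (Γ : List Formula) (ts us : List World) : Formula → Set where
  atom : ∀ {p} → Saturatedˡ Γ ts us (var p)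
  box  : Saturatedˡ Γ ts us (□ φ)
  ⊥⊃   : Saturatedˡ Γ ts us (⊥ ⊃ ψ)
  p⊃   : ∀ {p} → var p ∉ Γ → Saturatedˡ Γ ts us (var p ⊃ ψ)
  □⊃   : Any (λ u → ¬ u ⊩ φ) us → Saturatedˡ Γ ts us (□ φ ⊃ ψ)
  ⊃⊃   : Any (λ t → ¬ t ⊩ φ ⊃ ψ) ts → Saturatedˡ Γ ts us ((φ ⊃ ψ) ⊃ χ)

-- There is no case for ∧ or ⊃: their right rules are invertible, so the premises settle the sequent
-- without a new root.
data Saturatedʳ (Γ : List Formula) (ts us : List World) : Formula → Set where
  atom   : ∀ {p} → var p ∉ Γ → Saturatedʳ Γ ts us (var p)
  bottom : Saturatedʳ Γ ts us ⊥
  or     : Any (λ t → ¬ t ⊩ φ) ts → Any (λ t → ¬ t ⊩ ψ) ts → Saturatedʳ Γ ts us (φ ∨ ψ)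
  box    : Any (λ u → ¬ u ⊩ φ) us → Saturatedʳ Γ ts us (□ φ)

-- Children found for different formulas are pooled under one root, so each condition must survive
-- the arrival of more children.
Monotone : (List World → List World → Set) → Set
Monotone P = ∀ {ts us ts′ us′} → ts ⊆ ts′ → us ⊆ us′ → P ts us → P ts′ us′

Saturatedˡ-mono : Monotone λ ts us → Saturatedˡ Γ ts us φ
Saturatedˡ-mono f g atom   = atom
Saturatedˡ-mono f g box    = box
Saturatedˡ-mono f g ⊥⊃     = ⊥⊃
Saturatedˡ-mono f g (p⊃ x) = p⊃ x
Saturatedˡ-mono f g (□⊃ x) = □⊃ (Any-resp-⊆ g x)
Saturatedˡ-mono f g (⊃⊃ x) = ⊃⊃ (Any-resp-⊆ f x)

Saturatedʳ-mono : Monotone λ ts us → Saturatedʳ Γ ts us φ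
Saturatedʳ-mono f g (atom x) = atom x
Saturatedʳ-mono f g bottom   = bottom
Saturatedʳ-mono f g (or x y) = or (Any-resp-⊆ f x) (Any-resp-⊆ f y)
Saturatedʳ-mono f g (box x)  = box (Any-resp-⊆ g x)

module Root (children : Children Γ ts us) where
  root : World
  root = node Γ ts us

  intuitionistic : t ∈ ts → t ⊩* Γ
  intuitionistic = All.lookup (proj₁ children)

  modal : t ∈ us → All (t ⊩⁺_) Γ
  modal = All.lookup (proj₂ children)

  -- Every world strictly above the root inherits the implication from a child; only the root
  -- remains to be checked.
  root-⊃ : φ ⊃ ψ ∈ Γ → (root ⊩ φ → root ⊩ ψ) → root ⊩ φ ⊃ ψ
  root-⊃ φ⊃ψ∈Γ f ≼-refl      = f
  root-⊃ φ⊃ψ∈Γ f (≼-int x q) = All.lookup (intuitionistic x) φ⊃ψ∈Γ q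
  root-⊃ φ⊃ψ∈Γ f (≼-mod x q) = proj₁ (All.lookup (modal x) φ⊃ψ∈Γ) q

  refuted-int : Any (λ t → ¬ t ⊩ φ) ts → ¬ root ⊩ φ
  refuted-int {φ} x f with _ , t∈ts , ¬f ← find x = ¬f (persistent φ (≼-int t∈ts ≼-refl) f)

  refuted-mod : Any (λ u → ¬ u ⊩ φ) us → ¬ root ⊩ □ φ
  refuted-mod x f with _ , u∈us , ¬f ← find x = ¬f (f (◁-mod u∈us ≼-refl))

  -- For a box, successors through an intuitionistic child use that child's own box, and those
  -- through a modal child use the unboxed formula. The other implications hold at the root because
  -- it does not force their antecedents.
  root-forces : φ ∈ Γ → Saturatedˡ Γ ts us φ → root ⊩ φ
  root-forces x atom = λ where
    ≼-refl      → x
    (≼-int y q) → All.lookup (intuitionistic y) x q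
    (≼-mod y q) → proj₁ (All.lookup (modal y) x) q
  root-forces x (box {φ}) = λ where
    (◁-int y q) → All.lookup (intuitionistic y) x q
    (◁-mod y q) → persistent φ q (proj₂ (All.lookup (modal y) x) φ refl)
  root-forces x ⊥⊃     = root-⊃ x ⊥-elim
  root-forces x (p⊃ y) = root-⊃ x λ f → ⊥-elim (y (f ≼-refl))
  root-forces x (□⊃ {φ} y) = root-⊃ x λ f → ⊥-elim (refuted-mod {φ} y f)
  root-forces x (⊃⊃ {φ} {ψ} y) = root-⊃ x λ f → ⊥-elim (refuted-int {φ ⊃ ψ} y f)

  root-refutes : Saturatedʳ Γ ts us φ → ¬ root ⊩ φ
  root-refutes (atom x)           f        = x (f ≼-refl)
  root-refutes (or {φ} x y)       (inj₁ f) = refuted-int {φ} x f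
  root-refutes (or {ψ = ψ} x y)   (inj₂ g) = refuted-int {ψ} y g
  root-refutes (box {φ} x)        f        = refuted-mod {φ} x f

-- One step of the backward search

module Search (Γ : List Formula) (χ : Formula)
              (recurse : ∀ Δ δ → measure (Δ ⇒ δ) < measure (Γ ⇒ χ) → Result Δ δ) where

  -- Treating a single formula may already settle the whole sequent, by a proof or a countermodel;
  -- failing that, it contributes children for the root.
  Attempt : (List World → List World → Set) → Set
  Attempt P = Result Γ χ ⊎ (∃₂ λ ts us → Children Γ ts us × P ts us)

  saturated : ∀ {P} → P [] [] → Attempt P
  saturated x = inj₂ ([] , [] , ([] , []) , x)

  int-child : ∀ {P} → t ⊩* Γ → P [ t ] [] → Attempt P
  int-child f x = inj₂ (_ , _ , (f ∷ [] , []) , x)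

  mod-child : ∀ {P} → All (t ⊩⁺_) Γ → P [] [ t ] → Attempt P
  mod-child f x = inj₂ (_ , _ , ([] , f ∷ []) , x)

  both : ∀ {P Q} → Monotone P → Monotone Q → Attempt P → Attempt Q →
         Attempt (λ ts us → P ts us × Q ts us)
  both mP mQ (inj₁ r) _ = inj₁ r
  both mP mQ (inj₂ _) (inj₁ r) = inj₁ r
  both mP mQ (inj₂ (ts , us , (a , b) , x)) (inj₂ (ts′ , us′ , (a′ , b′) , y)) =
    inj₂ (ts ++ ts′ , us ++ us′ , (++⁺ a a′ , ++⁺ b b′)
         , mP (xs⊆xs++ys ts ts′) (xs⊆xs++ys us us′) x
         , mQ (xs⊆ys++xs ts′ ts) (xs⊆ys++xs us′ us) y)

  all : ∀ Δ {P : Formula → List World → List World → Set} → (∀ {φ} → Monotone (P φ)) →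
        (∀ {φ} → φ ∈ Δ → Attempt (P φ)) → Attempt (λ ts us → All (λ φ → P φ ts us) Δ)
  all []      mP f = saturated []
  all (φ ∷ Δ) mP f with both mP (λ a b → All.map (mP a b)) (f (here refl)) (all Δ mP (f ∘ there))
  ... | inj₁ r = inj₁ r
  ... | inj₂ (ts , us , c , x , xs) = inj₂ (ts , us , c , x ∷ xs)

  -- For a premise whose refutations also refute the conclusion: a countermodel ends the search, and
  -- a proof is handed on to the remaining premises.
  via : ∀ Δ δ → measure (Δ ⇒ δ) < measure (Γ ⇒ χ) →
        (∀ {t} → t ⊩* Δ → ¬ t ⊩ δ → t ⊩* Γ × ¬ t ⊩ χ) →
        ∀ {P} → (G4iSLt (Δ ⇒ δ) → Attempt P) → Attempt P
  via Δ δ small refute prove with recurse Δ δ small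
  ... | inj₁ d            = prove d
  ... | inj₂ (t , f , ¬g) = inj₁ (inj₂ (t , refute f ¬g))

  proved : ∀ {P} → G4iSLt (Γ ⇒ χ) → Attempt P
  proved d = inj₁ (inj₁ d)

  viaˡ : ∀ Ξ → Γ ↭ φ ∷ Π → length Ξ ≤ 4 → All (_≺ φ) Ξ → (∀ {t} → t ⊩* Ξ → t ⊩ φ) →
         ∀ {P} → (G4iSLt (Ξ ++ Π ⇒ χ) → Attempt P) → Attempt P
  viaˡ Ξ p l Ξ≺φ force = via (Ξ ++ _) χ (antecedent-smaller Ξ χ p l Ξ≺φ)
    λ f ¬g → All-resp-↭ (↭-sym p) (force (++⁻ˡ Ξ f) ∷ ++⁻ʳ Ξ f) , ¬g

  left : ∀ φ → φ ∈ Γ → Attempt (λ ts us → Saturatedˡ Γ ts us φ)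
  left φ x = left′ φ (proj₂ (extract x))
    where
    left′ : ∀ φ → Γ ↭ φ ∷ Π → Attempt (λ ts us → Saturatedˡ Γ ts us φ)
    left′ (var _) p = saturated atom
    left′ ⊥       p = proved (⊥L p)
    left′ (φ ∧ ψ) p =
      viaˡ (φ ∷ ψ ∷ []) p (m≤m+n 2 2)
        (m<n⇒m<1+n (m<1+m+n (weight φ) _) ∷ m<n⇒m<1+n (n<1+m+n (weight φ) _) ∷ [])
        (λ { (f ∷ g ∷ []) → f , g })
        λ d → proved (∧L p d)
    left′ (φ ∨ ψ) p =
      viaˡ [ φ ] p (m≤m+n 1 3) (m<1+m+n (weight φ) _ ∷ []) (λ { (f ∷ []) → inj₁ f }) λ d →
      viaˡ [ ψ ] p (m≤m+n 1 3) (n<1+m+n (weight φ) _ ∷ []) (λ { (f ∷ []) → inj₂ f }) λ e →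
      proved (∨L p d e)
    left′ (□ _)   p = saturated box
    left′ (⊥ ⊃ _) p = saturated ⊥⊃
    left′ (var q ⊃ ψ) p with var∈? q Γ
    ... | no q∉Γ = saturated (p⊃ q∉Γ)
    ... | yes q∈Γ with there q∈Π ← ∈-resp-↭ p q∈Γ with Π′ , p′ ← extract q∈Π =
      viaˡ [ ψ ] p″ (m≤m+n 1 3) (n<1+n _ ∷ []) (λ { {t} (f ∷ []) t≼u _ → persistent ψ t≼u f })
        λ d → proved (p→L p″ d)
      where p″ = ↭-trans p (prep _ p′)
    left′ (φ ∧ ψ ⊃ θ) p =
      viaˡ [ φ ⊃ ψ ⊃ θ ] p (m≤m+n 1 3) (curry≺ ∷ [])
        (λ { (f ∷ []) t≼u (g , h) → f t≼u g ≼-refl h })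
        λ d → proved (∧→L p d)
      where
      open ≡-Reasoning
      curry≺ : φ ⊃ ψ ⊃ θ ≺ φ ∧ ψ ⊃ θ
      curry≺ = ≤-reflexive (cong (2 +_) (begin
        weight φ + suc (weight ψ + weight θ) ≡⟨ +-suc (weight φ) _ ⟩
        suc (weight φ + (weight ψ + weight θ)) ≡⟨ cong suc (sym (+-assoc (weight φ) _ _)) ⟩
        suc (weight φ + weight ψ + weight θ) ∎))
    left′ (φ ∨ ψ ⊃ θ) p =
      viaˡ ((φ ⊃ θ) ∷ (ψ ⊃ θ) ∷ []) p (m≤m+n 2 2)
        (s≤s (s≤s (+-monoˡ-≤ _ (m≤m+n (weight φ) _))) ∷ s≤s (s≤s (+-monoˡ-≤ _ (m≤n+m _ (weight φ)))) ∷ [])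
        (λ { (f ∷ g ∷ []) t≼u → [ f t≼u , g t≼u ]′ })
        λ d → proved (∨→L p d)
    -- Refuting φ, ψ ⊃ θ, Π ⇒ ψ rather than the premise ψ ⊃ θ, Π ⇒ φ ⊃ ψ gives a
    -- world which forces φ, where ψ ⊃ θ entails (φ ⊃ ψ) ⊃ θ.
    left′ {Π} ((φ ⊃ ψ) ⊃ θ) p =
      viaˡ [ θ ] p (m≤m+n 1 3) (n<1+m+n (weight (φ ⊃ ψ)) _ ∷ [])
        (λ { (f ∷ []) t≼u _ → persistent θ t≼u f }) λ e →
      [ (λ d → proved (→→L p (→R d) e))
      , (λ { (t , f ∷ g ∷ fs , ¬h) → int-child
               (All-resp-↭ (↭-sym p) ((λ t≼u k → g t≼u (k ≼-refl (persistent φ t≼u f))) ∷ fs))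
               (⊃⊃ (here λ k → ¬h (k ≼-refl f))) })
      ]′ (recurse (φ ∷ (ψ ⊃ θ) ∷ Π) ψ
           (left-premise-smaller (φ ∷ (ψ ⊃ θ) ∷ []) Π ψ χ p ≤-refl ≤-refl
             (ψ≺ ∷ ψ≺ ∷ <-trans (m<1+m+n (weight φ) _) (m<1+m+n _ (weight θ))
              ∷ s≤s (s≤s (+-monoˡ-≤ _ (m≤n+m _ (weight φ)))) ∷ [])))
      where
      ψ≺ : ψ ≺ (φ ⊃ ψ) ⊃ θ
      ψ≺ = <-trans (n<1+m+n (weight φ) _) (m<1+m+n _ (weight θ))
    left′ {Π} (□ φ ⊃ ψ) p with Φ , Ψ , nbs , q ← unboxing Π =
      -- The right premise is invertible because ψ entails □ φ ⊃ ψ. If it is provable, the left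
      -- premise decides between applying the rule and adding a modal child that refutes φ.
      viaˡ [ ψ ] p′ (m≤m+n 1 3) (n<1+m+n (weight (□ φ)) _ ∷ [])
        (λ { (f ∷ []) t≼u _ → persistent ψ t≼u f }) λ e →
      [ (λ d → proved (□→L nbs p′ d e))
      , (λ { (t , _ ∷ f ∷ fs , ¬h) → mod-child
               (All-resp-↭ (↭-sym p) (((λ t≼u _ → persistent ψ t≼u f) , λ _ ()) ∷ ⊩⁺-unboxing Φ Ψ (nbs , q) fs))
               (□⊃ (here ¬h)) })
      ]′ (recurse (□ φ ∷ ψ ∷ Φ ++ Ψ) φ
           (left-premise-smaller (□ φ ∷ ψ ∷ []) (Φ ++ Ψ) φ χ p (size-unboxing Φ Ψ q) ≤-refl
             (φ≺ ∷ φ≺ ∷ m<1+m+n _ (weight ψ) ∷ n<1+m+n (weight (□ φ)) _ ∷ [])))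
      where
      p′ : Γ ↭ (□ φ ⊃ ψ) ∷ Φ ++ map □_ Ψ
      p′ = ↭-trans p (prep _ q)
      φ≺ : φ ≺ □ φ ⊃ ψ
      φ≺ = <-trans (n<1+n _) (m<1+m+n _ (weight ψ))

  viaʳ : ∀ Ξ δ → length (δ ∷ δ ∷ Ξ) ≤ 4 → All (_≺ χ) (δ ∷ δ ∷ Ξ) →
         (∀ {t} → t ⊩* Ξ → t ⊩ χ → t ⊩ δ) →
         ∀ {P} → (G4iSLt (Ξ ++ Γ ⇒ δ) → Attempt P) → Attempt P
  viaʳ Ξ δ l small force = via (Ξ ++ Γ) δ (subformula-smaller Ξ Γ δ χ l small)
    λ f ¬g → ++⁻ʳ Ξ f , ¬g ∘ force (++⁻ˡ Ξ f)

  right : ∀ φ → φ ≡ χ → Attempt (λ ts us → Saturatedʳ Γ ts us φ)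
  right (var p) refl with var∈? p Γ
  ... | yes p∈Γ = proved (IdP (proj₂ (extract p∈Γ)))
  ... | no  p∉Γ = saturated (atom p∉Γ)
  right ⊥       refl = saturated bottom
  right (φ ∧ ψ) refl =
    viaʳ [] φ (m≤m+n 2 2) (φ≺ ∷ φ≺ ∷ []) (λ _ → proj₁) λ d →
    viaʳ [] ψ (m≤m+n 2 2) (ψ≺ ∷ ψ≺ ∷ []) (λ _ → proj₂) λ e →
    proved (∧R d e)
    where
    φ≺ : φ ≺ φ ∧ ψ
    φ≺ = m<n⇒m<1+n (m<1+m+n (weight φ) _)
    ψ≺ : ψ ≺ φ ∧ ψ
    ψ≺ = m<n⇒m<1+n (n<1+m+n (weight φ) _)
  right (φ ∨ ψ) refl
    with recurse Γ φ (subformula-smaller [] Γ φ (φ ∨ ψ) (m≤m+n 2 2) (φ≺ ∷ φ≺ ∷ []))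
       | recurse Γ ψ (subformula-smaller [] Γ ψ (φ ∨ ψ) (m≤m+n 2 2) (ψ≺ ∷ ψ≺ ∷ []))
    where
    φ≺ : φ ≺ φ ∨ ψ
    φ≺ = m<1+m+n (weight φ) _
    ψ≺ : ψ ≺ φ ∨ ψ
    ψ≺ = n<1+m+n (weight φ) _
  ... | inj₁ d | _ = proved (∨R₁ d)
  ... | inj₂ _ | inj₁ e = proved (∨R₂ e)
  -- Neither world need refute the whole disjunction; a root below both does, by persistence.
  ... | inj₂ (t , f , ¬φ) | inj₂ (u , g , ¬ψ) =
    inj₂ (t ∷ u ∷ [] , [] , (f ∷ g ∷ [] , []) , or (here ¬φ) (there (here ¬ψ)))
  right (φ ⊃ ψ) refl =
    viaʳ [ φ ] ψ (m≤m+n 3 1) (ψ≺ ∷ ψ≺ ∷ m<1+m+n _ (weight ψ) ∷ [])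
      (λ { (f ∷ []) g → g ≼-refl f })
      λ d → proved (→R d)
    where
    ψ≺ : ψ ≺ φ ⊃ ψ
    ψ≺ = n<1+m+n (weight φ) _
  right (□ φ) refl with Φ , Ψ , nbs , p ← unboxing Γ
    with recurse (□ φ ∷ Φ ++ Ψ) φ (□-premise-smaller (Φ ++ Ψ) Γ φ (size-unboxing Φ Ψ p))
  ... | inj₁ d                = proved (SLtR nbs p d)
  ... | inj₂ (t , _ ∷ f , ¬φ) = mod-child (⊩⁺-unboxing Φ Ψ (nbs , p) f) (box (here ¬φ))

  result : Result Γ χ
  result with both (λ f g → All.map (Saturatedˡ-mono f g)) Saturatedʳ-mono
                   (all Γ Saturatedˡ-mono (left _)) (right χ refl)
  ... | inj₁ r = r
  ... | inj₂ (ts , us , children , l , r) =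
    inj₂ (root , All.tabulate (λ x → root-forces x (All.lookup l x)) , root-refutes r)
    where open Root children

-- Completeness and the equivalence

prove-or-refute : ∀ Γ χ → Acc _<_ (measure (Γ ⇒ χ)) → Result Γ χ
prove-or-refute Γ χ (acc rs) = Search.result Γ χ λ Δ δ small → prove-or-refute Δ δ (rs small)

mainTheorem2 : (φ : Formula) → (∅ ⊢iSLH φ) ⇔ G4iSLt ([] ⇒ φ)
mainTheorem2 φ = mk⇔ complete (λ d → bind (G4⇒Hilbert d) λ ())
  where
  complete : ∅ ⊢iSLH φ → G4iSLt ([] ⇒ φ)
  complete d with prove-or-refute [] φ (<-wellFounded _)
  ... | inj₁ e            = e
  ... | inj₂ (t , _ , ¬f) = ⊥-elim (¬f (Hilbert⇒⊩ d))
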